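{- There is a PRAX algorithm for the problem of tautology testing that works in time $O\big(|\alpha|\,(1/\varepsilon)\big)$, where $\alpha$ is the given CNF proposition and $\varepsilon\in(0,1)$ is the given tolerance.
   Context: An instance $\alpha=\alpha(v_1,\dots,v_k)$ is a proposition in conjunctive normal form (CNF) involving truth variables $v_1,\dots,v_k$; $|\alpha|$ is its size. $\mathcal{L}(\alpha)\subseteq\{\mathsf{T},\mathsf{F}\}^k$ is the set of truth assignments satisfying $\alpha$, and $\mathsf{B}(\alpha)=|\mathcal{L}(\alpha)|/2^k$ is its probability under the uniform distribution on $\{\mathsf{T},\mathsf{F}\}^k$. Tautology testing is the universality problem $U_{\mathsf{B}}=\{\alpha:\mathsf{B}(\alpha)=1\}$ (all $2^k$ truth assignments satisfy $\alpha$), and for $\varepsilon\in(0,1)$, $U_{\mathsf{B},\varepsilon}=\{\alpha:\mathsf{B}(\alpha)\ge1-\varepsilon\}$. A PRAX algorithm for $U_{\mathsf{B}}$ is a randomized algorithm $A(\alpha,\varepsilon)$ that halts on every input with answer $\mathsf{True}$ or $\mathsf{False}$ such that: (1) if $\alpha\in U_{\mathsf{B}}$ then $A(\alpha,\varepsilon)=\mathsf{True}$; (2) if $\alpha\notin U_{\mathsf{B},\varepsilon}$ then $\mathrm{P}[A(\alpha,\varepsilon)=\mathsf{False}]\ge 3/4$; (3) $A(\alpha,\varepsilon)$ works in time polynomial in $1/\varepsilon$ and the size of $\alpha$. Computational model: unit cost for arithmetic operations and for tossing a coin; testing whether a truth assignment satisfies $\alpha$ costs $O(|\alpha|)$.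
   Formalization: The tolerance ε is taken to be a rational number in (0,1), given to the algorithm by its numerator and denominator, instead of an arbitrary real number in (0,1). -}

module Defs where

open import Algebra.Definitions.RawSemiring using () renaming (_^_ to pow)
open import Data.Bool using (Bool; true; false; if_then_else_)
import Data.Bool as Bool
open import Data.Bool.ListAction using (any; all)
open import Data.Empty using (⊥)
open import Data.Fin using (Fin; toℕ)
open import Data.Integer using (+_; ∣_∣)
open import Data.List using (List; []; _∷_; _++_; map; concatMap; length; filterᵇ)
open import Data.Nat using (ℕ; zero; suc; _<ᵇ_; _≡ᵇ_)
import Data.Nat as ℕ
import Data.Nat.DivMod as ℕ
import Data.Nat.Properties as ℕ
open import Data.Product using (∃-syntax; _×_; proj₁)
open import Data.Rational
  using (ℚ; 0ℚ; 1ℚ; ½; _/_; _+_; _-_; _*_; _≤_; _<_; ↥_; ↧ₙ_; 1/_; >-nonZero; +-*-rawSemiring)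
open import Data.Unit using (⊤)
open import Data.Vec using (Vec; []; _∷_; lookup)
open import Relation.Binary.PropositionalEquality using (_≡_)
open import Relation.Nullary using (¬_)

fromℕ : ℕ → ℚ
fromℕ n = + n / 1

data Literal (k : ℕ) : Set where
  pos neg : Fin k → Literal k

Clause : ℕ → Set
Clause k = List (Literal k)

-- α = α(v₁,…,v_k), a conjunction of disjunctions of literals.  Variables
-- that occur in no clause are allowed.
record CNF : Set where
  constructor cnf
  field
    vars    : ℕ
    clauses : List (Clause vars)
open CNF public

Assignment : ℕ → Set
Assignment k = Vec Bool k

satLiteral : ∀ {k} → Assignment k → Literal k → Bool
satLiteral σ (pos i) = lookup σ i
satLiteral σ (neg i) = Bool.not (lookup σ i)

satisfies : (α : CNF) → Assignment (vars α) → Bool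
satisfies α σ = all (any (satLiteral σ)) (clauses α)

assignments : ∀ k → List (Assignment k)
assignments zero    = [] ∷ []
assignments (suc k) = map (true ∷_) (assignments k) ++ map (false ∷_) (assignments k)

𝓛 : (α : CNF) → List (Assignment (vars α))
𝓛 α = filterᵇ (satisfies α) (assignments (vars α))

𝖡 : CNF → ℚ
𝖡 α = (+ length (𝓛 α) / (2 ℕ.^ vars α)) {{ℕ.m^n≢0 2 (vars α)}}

-- The written form of α, similar to the DIMACS format: the number of
-- variables, followed by the clauses, each terminated by 0.
encodeLiteral : ∀ {k} → Literal k → ℕ
encodeLiteral (pos i) = 1 ℕ.+ 2 ℕ.* toℕ i
encodeLiteral (neg i) = 2 ℕ.+ 2 ℕ.* toℕ i

encodeClause : ∀ {k} → Clause k → List ℕ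
encodeClause c = map encodeLiteral c ++ 0 ∷ []

encode : CNF → List ℕ
encode α = vars α ∷ concatMap encodeClause (clauses α)

-- |α| counts literal occurrences and clauses, plus one.  The number of
-- variables is written in a single cell, so unused variables do not
-- increase the size.
size : CNF → ℕ
size α = length (encode α)

-- An algorithm needs a finite description of ε, so ε is rational.
record Tolerance : Set where
  constructor tolerance
  field
    ε   : ℚ
    0<ε : 0ℚ < ε
    ε<1 : ε < 1ℚ
open Tolerance public

1/ε : Tolerance → ℚ
1/ε t = 1/_ (ε t) {{>-nonZero (0<ε t)}}

U𝖡 : CNF → Set
U𝖡 α = 𝖡 α ≡ 1ℚ

U𝖡,ε : Tolerance → CNF → Set
U𝖡,ε t α = 1ℚ - ε t ≤ 𝖡 α

record State : Set where
  constructor state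
  field
    reg : ℕ → ℕ
    mem : ℕ → ℕ
open State public

infix 11 $_
infix 10 #_ !_
infix 6 _≔_⟨_⟩_ toss_ when_<_then_otherwise_ while_<_loop_

-- A place is a register or the memory cell whose address is in a register.
data Place : Set where
  $_   : ℕ → Place
  M[_] : ℕ → Place

data Operand : Set where
  #_ : ℕ → Operand
  !_ : Place → Operand

data Op : Set where
  add sub mul div : Op

mutual
  data Command : Set where
    _≔_⟨_⟩_                : Place → Operand → Op → Operand → Command
    toss_                  : Place → Command
    when_<_then_otherwise_ : Operand → Operand → Program → Program → Command
    while_<_loop_          : Operand → Operand → Program → Command

  Program : Set
  Program = List Command

-- Subtraction is truncated, division rounds down, and n / 0 = 0.
apply : Op → ℕ → ℕ → ℕ
apply add m n       = m ℕ.+ n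
apply sub m n       = m ℕ.∸ n
apply mul m n       = m ℕ.* n
apply div m zero    = 0
apply div m (suc n) = m ℕ./ suc n

read : State → Place → ℕ
read s ($ r)  = reg s r
read s M[ r ] = mem s (reg s r)

value : State → Operand → ℕ
value s (# n) = n
value s (! p) = read s p

update : (ℕ → ℕ) → ℕ → ℕ → ℕ → ℕ
update f a v b = if b ≡ᵇ a then v else f b

write : State → Place → ℕ → State
write s ($ r)  v = state (update (reg s) r v) (mem s)
write s M[ r ] v = state (reg s) (update (mem s) (reg s r) v)

-- The tree of all computations within a time budget, branching at coin tosses.
data Run : Set where
  halted  : State → Run
  timeout : Run
  coin    : Run → Run → Run

-- Each executed command or evaluated test takes one unit of time.  The
-- list of commands is what remains to be executed.
run : (budget : ℕ) → Program → State → Run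
run t       []       s = halted s
run zero    (c ∷ cs) s = timeout
run (suc t) ((p ≔ x ⟨ o ⟩ y) ∷ cs) s = run t cs (write s p (apply o (value s x) (value s y)))
run (suc t) ((toss p) ∷ cs) s = coin (run t cs (write s p 0)) (run t cs (write s p 1))
run (suc t) ((when x < y then c otherwise d) ∷ cs) s =
  if value s x <ᵇ value s y then run t (c ++ cs) s else run t (d ++ cs) s
run (suc t) ((while x < y loop c) ∷ cs) s =
  if value s x <ᵇ value s y then run t (c ++ (while x < y loop c) ∷ cs) s else run t cs s

Always : (State → Set) → Run → Set
Always P (halted s) = P s
Always P timeout    = ⊥
Always P (coin l r) = Always P l × Always P r

Prob : (State → Bool) → Run → ℚ
Prob P (halted s) = if P s then 1ℚ else 0ℚ
Prob P timeout    = 0ℚ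
Prob P (coin l r) = ½ * Prob P l + ½ * Prob P r

-- Initially register 0 holds the length of the input and the other
-- registers hold 0; the input is in the memory from address 0 on, followed
-- by zeros.
cell : List ℕ → ℕ → ℕ
cell []       _       = 0
cell (x ∷ xs) zero    = x
cell (x ∷ xs) (suc i) = cell xs i

load : List ℕ → State
load xs = state (update (λ _ → 0) 0 (length xs)) (cell xs)

-- The answer is False exactly when register 0 finally holds 0.
answer : State → Bool
answer s = 0 <ᵇ reg s 0

input : CNF → Tolerance → State
input α t = load (∣ ↥ (ε t) ∣ ∷ ↧ₙ (ε t) ∷ encode α)

HaltsWithin : ℕ → Program → State → Set
HaltsWithin n p s = Always (λ _ → ⊤) (run n p s)

-- Coin tosses branch in two, so halting under every sequence of coin
-- outcomes amounts to halting within some time that depends on the input only.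
record Algorithm : Set where
  field
    program : Program
    halts   : ∀ α t → ∃[ n ] HaltsWithin n program (input α t)

  -- Beyond a sufficient budget the tree no longer depends on the budget.
  execution : CNF → Tolerance → Run
  execution α t = run (proj₁ (halts α t)) program (input α t)

  WorksInTime : CNF → Tolerance → ℚ → Set
  WorksInTime α t b = ∃[ n ] (fromℕ n ≤ b × HaltsWithin n program (input α t))
open Algorithm public

infixr 8 _^_
_^_ : ℚ → ℕ → ℚ
_^_ = pow +-*-rawSemiring

record IsPRAX (A : Algorithm) : Set where
  field
    accepts : ∀ α t → U𝖡 α → Always (λ s → answer s ≡ true) (execution A α t)
    rejects : ∀ α t → ¬ U𝖡,ε t α →
              + 3 / 4 ≤ Prob (λ s → Bool.not (answer s)) (execution A α t)
    -- Since |α| ≥ 1 and 1/ε > 1, every polynomial in |α| and 1/ε is bounded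
    -- by one of the form c |α|^d (1/ε)^e.
    polynomial : ∃[ c ] ∃[ d ] ∃[ e ] ∀ α t →
                 WorksInTime A α t (fromℕ c * fromℕ (size α) ^ d * 1/ε t ^ e)

{-# OPTIONS --safe #-}
module Submission where

open import Defs
open import Data.Bool using (Bool; true; false; T; if_then_else_; not; _∧_; _∨_)
open import Data.Bool.ListAction using (any; all)
import Data.Bool.Properties as Bool
open import Data.Empty using (⊥)
open import Data.Fin using (Fin; zero; suc; toℕ)
import Data.Fin.Properties as Fin
open import Data.Integer using (+_; -[1+_]; +[1+_]; ∣_∣)
import Data.Integer as ℤ
import Data.Integer.Properties as ℤ
open import Data.List using (List; []; _∷_; _++_; map; concatMap; length; drop; filterᵇ)
import Data.List.Properties as List
open import Data.List.Membership.Propositional using (_∈_)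
open import Data.List.Membership.Propositional.Properties using (∈-++⁺ˡ; ∈-++⁺ʳ)
open import Data.List.Relation.Unary.Any using (here; there)
open import Data.Nat using (ℕ; zero; suc; _<ᵇ_; _≡ᵇ_)
import Data.Nat as ℕ
import Data.Nat.DivMod as ℕ
import Data.Nat.Properties as ℕ
open import Data.Nat.Tactic.RingSolver using (solve-∀)
open import Data.Product using (Σ-syntax; _×_; _,_; proj₁; proj₂)
open import Data.Rational
  using (ℚ; mkℚ; 0ℚ; 1ℚ; ½; _/_; _+_; _-_; _*_; _≤_; *<*; ↥_; ↧ₙ_; toℚᵘ)
import Data.Rational as ℚ
import Data.Rational.Properties as ℚ
open import Data.Rational.Solver using (module +-*-Solver)
open import Data.Rational.Unnormalised using (mkℚᵘ; *≡*)
import Data.Rational.Unnormalised as ℚᵘ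
import Data.Rational.Unnormalised.Properties as ℚᵘ
open import Data.Sum using (_⊎_; inj₁; inj₂)
open import Data.Unit using (⊤; tt)
open import Data.Vec using ([]; _∷_; lookup; _[_]≔_; replicate)
import Data.Vec.Properties as Vec
open import Function using (_∘_)
open import Relation.Binary.PropositionalEquality
open import Relation.Nullary using (¬_; yes; no)

-- The algorithm evaluates α at N = ⌊3/ε⌋ + 1 independent random assignments
-- and answers True when all of them satisfy α.  The probability of the answer
-- True is exactly 𝖡(α)^N.  If 𝖡(α) = 1, this probability is 1, so every
-- computation answers True (Prob≡1⇒Always).  If 𝖡(α) < 1 - ε, this probability is
-- at most 1/4, because (1 - ε)^N (1 + Nε) ≤ 1 and Nε ≥ 3 (power≤¼).
--
-- A round must cost O(|α|), while the number of variables of α is not bounded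
-- in terms of |α|.  Therefore no complete assignment is sampled.  A round first
-- scans the formula and tosses a coin for the variable of each literal
-- occurrence, overwriting earlier tosses for the same variable, and leaves the
-- other variables as they were; then it scans the formula again and evaluates
-- it.  The resulting probability is nevertheless 𝖡(α): re-tossing a
-- coordinate does not change the uniform average of a function of assignments
-- (avg-toss-at), and once every variable on which the function depends has been
-- tossed, the result no longer depends on the initial assignment, so that it
-- equals its own average (toss-all-avg).
--
-- The machine program is verified by a small program logic: Accepts x t p s says
-- that p started in s halts within t steps whatever the coins show and answers
-- True with probability x.  Each loop has a lemma in continuation-passing
-- form: if the remaining program accepts with probability g τ whenever it
-- starts at assignment τ, then the loop followed by it accepts with the
-- probability obtained from g by the tosses of the loop.  The number of steps
-- does not depend on the coins, so it is given by an explicit recursion.  A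
-- round takes O(|α|) steps, and N ≤ 4/ε.

-- Natural numbers among the rationals

toℚᵘ-/ : ∀ m d → toℚᵘ (+ m / suc d) ℚᵘ.≃ mkℚᵘ (+ m) d
toℚᵘ-/ m d = ℚ.toℚᵘ-fromℚᵘ (mkℚᵘ (+ m) d)

fromℕ-+ : ∀ m n → fromℕ (m ℕ.+ n) ≡ fromℕ m + fromℕ n
fromℕ-+ m n = ℚ.toℚᵘ-injective (begin
  toℚᵘ (fromℕ (m ℕ.+ n))                  ≈⟨ toℚᵘ-/ (m ℕ.+ n) 0 ⟩
  mkℚᵘ (+ (m ℕ.+ n)) 0                    ≈⟨ *≡* (cong (ℤ._* + 1)
                                               (sym (cong₂ ℤ._+_ (ℤ.*-identityʳ (+ m)) (ℤ.*-identityʳ (+ n))))) ⟩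
  mkℚᵘ (+ m) 0 ℚᵘ.+ mkℚᵘ (+ n) 0          ≈⟨ ℚᵘ.+-cong (toℚᵘ-/ m 0) (toℚᵘ-/ n 0) ⟨
  toℚᵘ (fromℕ m) ℚᵘ.+ toℚᵘ (fromℕ n)      ≈⟨ ℚ.toℚᵘ-homo-+ (fromℕ m) (fromℕ n) ⟨
  toℚᵘ (fromℕ m + fromℕ n)                ∎)
  where open import Relation.Binary.Reasoning.Setoid ℚᵘ.≃-setoid

fromℕ-* : ∀ m n → fromℕ (m ℕ.* n) ≡ fromℕ m * fromℕ n
fromℕ-* m n = ℚ.toℚᵘ-injective (begin
  toℚᵘ (fromℕ (m ℕ.* n))                  ≈⟨ toℚᵘ-/ (m ℕ.* n) 0 ⟩
  mkℚᵘ (+ (m ℕ.* n)) 0                    ≈⟨ *≡* (cong (ℤ._* + 1) (ℤ.pos-* m n)) ⟩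
  mkℚᵘ (+ m) 0 ℚᵘ.* mkℚᵘ (+ n) 0          ≈⟨ ℚᵘ.*-cong (toℚᵘ-/ m 0) (toℚᵘ-/ n 0) ⟨
  toℚᵘ (fromℕ m) ℚᵘ.* toℚᵘ (fromℕ n)      ≈⟨ ℚ.toℚᵘ-homo-* (fromℕ m) (fromℕ n) ⟨
  toℚᵘ (fromℕ m * fromℕ n)                ∎)
  where open import Relation.Binary.Reasoning.Setoid ℚᵘ.≃-setoid

/-*-cancel : ∀ m d .{{_ : ℕ.NonZero d}} → (+ m / d) * fromℕ d ≡ fromℕ m
/-*-cancel m d@(suc d-1) = ℚ.toℚᵘ-injective (begin
  toℚᵘ ((+ m / d) * fromℕ d)              ≈⟨ ℚ.toℚᵘ-homo-* (+ m / d) (fromℕ d) ⟩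
  toℚᵘ (+ m / d) ℚᵘ.* toℚᵘ (fromℕ d)      ≈⟨ ℚᵘ.*-cong (toℚᵘ-/ m d-1) (toℚᵘ-/ d 0) ⟩
  mkℚᵘ (+ m) d-1 ℚᵘ.* mkℚᵘ (+ d) 0        ≈⟨ *≡* (trans (ℤ.*-identityʳ (+ m ℤ.* + d))
                                               (cong (λ x → + m ℤ.* + x) (sym (ℕ.*-identityʳ d)))) ⟩
  mkℚᵘ (+ m) 0                            ≈⟨ toℚᵘ-/ m 0 ⟨
  toℚᵘ (fromℕ m)                          ∎)
  where open import Relation.Binary.Reasoning.Setoid ℚᵘ.≃-setoid

fromℕ-positive : ∀ n .{{_ : ℕ.NonZero n}} → ℚ.Positive (fromℕ n)
fromℕ-positive n = ℚ.normalize-pos n 1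

fromℕ-nonNegative : ∀ n → ℚ.NonNegative (fromℕ n)
fromℕ-nonNegative n = ℚ.normalize-nonNeg n 1

fromℕ-mono-≤ : ∀ {m n} → m ℕ.≤ n → fromℕ m ≤ fromℕ n
fromℕ-mono-≤ {m} {n} m≤n = begin
  fromℕ m                      ≡⟨ ℚ.+-identityʳ (fromℕ m) ⟨
  fromℕ m + 0ℚ                 ≤⟨ ℚ.+-monoʳ-≤ (fromℕ m) n-m≥0 ⟩
  fromℕ m + fromℕ (n ℕ.∸ m)    ≡⟨ fromℕ-+ m (n ℕ.∸ m) ⟨
  fromℕ (m ℕ.+ (n ℕ.∸ m))      ≡⟨ cong fromℕ (ℕ.m+[n∸m]≡n m≤n) ⟩
  fromℕ n                      ∎
  where
  open ℚ.≤-Reasoning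
  n-m≥0 : 0ℚ ≤ fromℕ (n ℕ.∸ m)
  n-m≥0 = ℚ.nonNegative⁻¹ (fromℕ (n ℕ.∸ m)) {{fromℕ-nonNegative (n ℕ.∸ m)}}

-- Uniform averages and coin tosses

-- The expected value of a fair choice between x and y.
mid : ℚ → ℚ → ℚ
mid x y = ½ * x + ½ * y

mid-idem : ∀ x → mid x x ≡ x
mid-idem x = trans (sym (ℚ.*-distribʳ-+ x ½ ½)) (ℚ.*-identityˡ x)

mid-comm : ∀ x y → mid x y ≡ mid y x
mid-comm x y = ℚ.+-comm (½ * x) (½ * y)

mid-interchange : ∀ a b c d → mid (mid a b) (mid c d) ≡ mid (mid a c) (mid b d)
mid-interchange = solve 4 (λ a b c d →
  con ½ :* (con ½ :* a :+ con ½ :* b) :+ con ½ :* (con ½ :* c :+ con ½ :* d) :=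
  con ½ :* (con ½ :* a :+ con ½ :* c) :+ con ½ :* (con ½ :* b :+ con ½ :* d)) refl
  where open +-*-Solver

mid-* : ∀ x y z → mid (x * z) (y * z) ≡ mid x y * z
mid-* = solve 3 (λ x y z →
  con ½ :* (x :* z) :+ con ½ :* (y :* z) := (con ½ :* x :+ con ½ :* y) :* z) refl
  where open +-*-Solver

-- The expected value of f at a uniformly random assignment.
avg : ∀ {k} → (Assignment k → ℚ) → ℚ
avg {zero}  f = f []
avg {suc k} f = mid (avg (f ∘ (true ∷_))) (avg (f ∘ (false ∷_)))

avg-cong : ∀ {k} {f g : Assignment k → ℚ} → (∀ σ → f σ ≡ g σ) → avg f ≡ avg g
avg-cong {zero}  f≗g = f≗g []
avg-cong {suc k} f≗g = cong₂ mid (avg-cong (f≗g ∘ (true ∷_))) (avg-cong (f≗g ∘ (false ∷_)))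

avg-const : ∀ {k} x → avg {k} (λ _ → x) ≡ x
avg-const {zero}  x = refl
avg-const {suc k} x = trans (cong₂ mid (avg-const {k} x) (avg-const {k} x)) (mid-idem x)

avg-* : ∀ {k} (f : Assignment k → ℚ) x → avg (λ σ → f σ * x) ≡ avg f * x
avg-* {zero}  f x = refl
avg-* {suc k} f x =
  trans (cong₂ mid (avg-* (f ∘ (true ∷_)) x) (avg-* (f ∘ (false ∷_)) x))
        (mid-* (avg (f ∘ (true ∷_))) (avg (f ∘ (false ∷_))) x)

avg-mid : ∀ {k} (f g : Assignment k → ℚ) → avg (λ σ → mid (f σ) (g σ)) ≡ mid (avg f) (avg g)
avg-mid {zero}  f g = refl
avg-mid {suc k} f g =
  trans (cong₂ mid (avg-mid (f ∘ (true ∷_)) (g ∘ (true ∷_))) (avg-mid (f ∘ (false ∷_)) (g ∘ (false ∷_))))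
        (mid-interchange (avg (f ∘ (true ∷_))) (avg (g ∘ (true ∷_)))
                         (avg (f ∘ (false ∷_))) (avg (g ∘ (false ∷_))))

-- The expected value of f after a fair coin has replaced coordinate i of the
-- given assignment.  False comes first, as 0 is the first outcome of a toss.
toss-at : ∀ {k} → Fin k → (Assignment k → ℚ) → Assignment k → ℚ
toss-at i f σ = mid (f (σ [ i ]≔ false)) (f (σ [ i ]≔ true))

-- A uniformly random assignment stays uniformly random when one of its
-- coordinates is tossed again.
avg-toss-at : ∀ {k} (i : Fin k) f → avg (toss-at i f) ≡ avg f
avg-toss-at zero f =
  trans (mid-idem (avg (λ σ → mid (f (false ∷ σ)) (f (true ∷ σ)))))
  (trans (avg-mid (f ∘ (false ∷_)) (f ∘ (true ∷_)))
         (mid-comm (avg (f ∘ (false ∷_))) (avg (f ∘ (true ∷_)))))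
avg-toss-at (suc i) f = cong₂ mid (avg-toss-at i (f ∘ (true ∷_))) (avg-toss-at i (f ∘ (false ∷_)))

-- The expected value of f after successive tosses of the listed coordinates,
-- which may repeat.
toss-all : ∀ {k} → List (Fin k) → (Assignment k → ℚ) → Assignment k → ℚ
toss-all []       f = f
toss-all (i ∷ is) f = toss-at i (toss-all is f)

avg-toss-all : ∀ {k} (is : List (Fin k)) f → avg (toss-all is f) ≡ avg f
avg-toss-all []       f = refl
avg-toss-all (i ∷ is) f = trans (avg-toss-at i (toss-all is f)) (avg-toss-all is f)

-- The value of f is determined by the coordinates in the list.
DependsOn : ∀ {k} {A : Set} → List (Fin k) → (Assignment k → A) → Set
DependsOn is f = ∀ σ τ → (∀ {i} → i ∈ is → lookup σ i ≡ lookup τ i) → f σ ≡ f τ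

-- After the tosses, two assignments give the same expected value if they agree
-- on the coordinates that f depends on and that are not tossed.
toss-all-constant : ∀ {k} (is : List (Fin k)) {js} {f} → DependsOn js f → ∀ σ τ →
  (∀ {j} → j ∈ js → j ∈ is ⊎ lookup σ j ≡ lookup τ j) → toss-all is f σ ≡ toss-all is f τ
toss-all-constant []       dep σ τ agree = dep σ τ λ j∈ → case (agree j∈)
  where
  case : ∀ {j} → j ∈ [] ⊎ lookup σ j ≡ lookup τ j → lookup σ j ≡ lookup τ j
  case (inj₂ eq) = eq
toss-all-constant (i ∷ is) {js} {f} dep σ τ agree = cong₂ mid (branch false) (branch true)
  where
  branch : ∀ b → toss-all is f (σ [ i ]≔ b) ≡ toss-all is f (τ [ i ]≔ b)
  branch b = toss-all-constant is dep (σ [ i ]≔ b) (τ [ i ]≔ b) λ {j} j∈ → updated j (agree j∈)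
    where
    updated : ∀ j → j ∈ i ∷ is ⊎ lookup σ j ≡ lookup τ j →
              j ∈ is ⊎ lookup (σ [ i ]≔ b) j ≡ lookup (τ [ i ]≔ b) j
    updated j p with j Fin.≟ i
    updated j p                 | yes refl =
      inj₂ (trans (Vec.lookup∘update i σ b) (sym (Vec.lookup∘update i τ b)))
    updated j (inj₁ (here j≡i)) | no j≢i with () ← j≢i j≡i
    updated j (inj₁ (there j∈)) | no j≢i = inj₁ j∈
    updated j (inj₂ eq)         | no j≢i =
      inj₂ (trans (Vec.lookup∘update′ j≢i σ b) (trans eq (sym (Vec.lookup∘update′ j≢i τ b))))

-- Tossing every coordinate that f depends on amounts to sampling a uniformly
-- random assignment.
toss-all-avg : ∀ {k} (is : List (Fin k)) f → DependsOn is f → ∀ σ → toss-all is f σ ≡ avg f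
toss-all-avg {k} is f dep σ = begin
  toss-all is f σ                      ≡⟨ avg-const {k} (toss-all is f σ) ⟨
  avg {k} (λ _ → toss-all is f σ)      ≡⟨ avg-cong (λ τ → toss-all-constant is dep σ τ inj₁) ⟩
  avg (toss-all is f)                  ≡⟨ avg-toss-all is f ⟩
  avg f                                ∎
  where open ≡-Reasoning

-- The probability of a formula as an average

-- The 0-1 value of a truth value; its average is a probability.
indicator : Bool → ℚ
indicator b = if b then 1ℚ else 0ℚ

-- The number of list elements that satisfy P.
count : ∀ {A : Set} → (A → Bool) → List A → ℕ
count P xs = length (filterᵇ P xs)

count-++ : ∀ {A : Set} (P : A → Bool) xs ys → count P (xs ++ ys) ≡ count P xs ℕ.+ count P ys
count-++ P []       ys = refl
count-++ P (x ∷ xs) ys with P x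
... | true  = cong suc (count-++ P xs ys)
... | false = count-++ P xs ys

count-map : ∀ {A B : Set} (P : B → Bool) (f : A → B) xs → count P (map f xs) ≡ count (P ∘ f) xs
count-map P f []       = refl
count-map P f (x ∷ xs) with P (f x)
... | true  = cong suc (count-map P f xs)
... | false = count-map P f xs

-- Counting satisfying assignments, without division.
count-assignments : ∀ k (P : Assignment k → Bool) →
  fromℕ (count P (assignments k)) ≡ avg (indicator ∘ P) * fromℕ (2 ℕ.^ k)
count-assignments zero P with P []
... | true  = refl
... | false = refl
count-assignments (suc k) P = begin
  fromℕ (count P (map (true ∷_) as ++ map (false ∷_) as))
    ≡⟨ cong fromℕ (count-++ P (map (true ∷_) as) (map (false ∷_) as)) ⟩
  fromℕ (count P (map (true ∷_) as) ℕ.+ count P (map (false ∷_) as))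
    ≡⟨ cong fromℕ (cong₂ ℕ._+_ (count-map P (true ∷_) as) (count-map P (false ∷_) as)) ⟩
  fromℕ (count (P ∘ (true ∷_)) as ℕ.+ count (P ∘ (false ∷_)) as)
    ≡⟨ fromℕ-+ (count (P ∘ (true ∷_)) as) (count (P ∘ (false ∷_)) as) ⟩
  fromℕ (count (P ∘ (true ∷_)) as) + fromℕ (count (P ∘ (false ∷_)) as)
    ≡⟨ cong₂ _+_ (count-assignments k (P ∘ (true ∷_))) (count-assignments k (P ∘ (false ∷_))) ⟩
  x * d + y * d
    ≡⟨ solve 3 (λ x y d → x :* d :+ y :* d :=
         (con ½ :* x :+ con ½ :* y) :* (con (fromℕ 2) :* d)) refl x y d ⟩
  mid x y * (fromℕ 2 * d)
    ≡⟨ cong (mid x y *_) (fromℕ-* 2 (2 ℕ.^ k)) ⟨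
  mid x y * fromℕ (2 ℕ.^ suc k) ∎
  where
  open ≡-Reasoning
  open +-*-Solver
  as = assignments k
  x = avg (indicator ∘ P ∘ (true ∷_))
  y = avg (indicator ∘ P ∘ (false ∷_))
  d = fromℕ (2 ℕ.^ k)

*-cancelʳ : ∀ x y z .{{_ : ℚ.Positive z}} → x * z ≡ y * z → x ≡ y
*-cancelʳ x y z eq = ℚ.≤-antisym (ℚ.*-cancelʳ-≤-pos z (ℚ.≤-reflexive eq))
                                 (ℚ.*-cancelʳ-≤-pos z (ℚ.≤-reflexive (sym eq)))

𝖡≡avg : ∀ α → 𝖡 α ≡ avg (indicator ∘ satisfies α)
𝖡≡avg α = *-cancelʳ (𝖡 α) (avg (indicator ∘ satisfies α)) (fromℕ (2 ℕ.^ vars α))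
  {{fromℕ-positive (2 ℕ.^ vars α) {{ℕ.m^n≢0 2 (vars α)}}}}
  (trans (/-*-cancel (length (𝓛 α)) (2 ℕ.^ vars α) {{ℕ.m^n≢0 2 (vars α)}})
         (count-assignments (vars α) (satisfies α)))

𝖡-nonNegative : ∀ α → ℚ.NonNegative (𝖡 α)
𝖡-nonNegative α = ℚ.normalize-nonNeg (length (𝓛 α)) (2 ℕ.^ vars α) {{ℕ.m^n≢0 2 (vars α)}}

-- The variable of a literal.
var : ∀ {k} → Literal k → Fin k
var (pos i) = i
var (neg i) = i

-- The variables of all literal occurrences, in the order of the written form.
occurrences : ∀ {k} → List (Clause k) → List (Fin k)
occurrences = concatMap (map var)

any-dependsOn : ∀ {k} (c : Clause k) → DependsOn (map var c) (λ σ → any (satLiteral σ) c)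
any-dependsOn []      σ τ agree = refl
any-dependsOn (l ∷ c) σ τ agree =
  cong₂ _∨_ (literal l (agree (here refl))) (any-dependsOn c σ τ (agree ∘ there))
  where
  literal : ∀ l → lookup σ (var l) ≡ lookup τ (var l) → satLiteral σ l ≡ satLiteral τ l
  literal (pos i) eq = eq
  literal (neg i) eq = cong not eq

all-dependsOn : ∀ {k} (cs : List (Clause k)) →
  DependsOn (occurrences cs) (λ σ → all (any (satLiteral σ)) cs)
all-dependsOn []       σ τ agree = refl
all-dependsOn (c ∷ cs) σ τ agree =
  cong₂ _∧_ (any-dependsOn c σ τ (agree ∘ ∈-++⁺ˡ))
            (all-dependsOn cs σ τ (agree ∘ ∈-++⁺ʳ (map var c)))

-- Powers of the acceptance probability

^-nonNegative : ∀ x .{{_ : ℚ.NonNegative x}} n → ℚ.NonNegative (x ^ n)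
^-nonNegative x zero    = _
^-nonNegative x (suc n) = ℚ.nonNeg*nonNeg⇒nonNeg x (x ^ n) {{^-nonNegative x n}}

1^n≡1 : ∀ n → 1ℚ ^ n ≡ 1ℚ
1^n≡1 zero    = refl
1^n≡1 (suc n) = trans (ℚ.*-identityˡ (1ℚ ^ n)) (1^n≡1 n)

-- For x ≤ 1 - e, the product xⁿ(1 + ne) does not increase with n, because
-- (1 - e)(1 + (n + 1)e) = 1 + ne - (n + 1)e².
bernoulli : ∀ {x e} .{{_ : ℚ.NonNegative x}} .{{_ : ℚ.NonNegative e}} → x ≤ 1ℚ - e → ∀ n →
  x ^ n * (1ℚ + fromℕ n * e) ≤ 1ℚ
bernoulli {x} {e} x≤1-e zero = ℚ.≤-reflexive (trans (ℚ.*-identityˡ (1ℚ + 0ℚ * e))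
  (trans (cong (λ y → 1ℚ + y) (ℚ.*-zeroˡ e)) (ℚ.+-identityʳ 1ℚ)))
bernoulli {x} {e} x≤1-e (suc n) = begin
  x * x ^ n * (1ℚ + fromℕ (suc n) * e)
    ≡⟨ cong (λ y → x * x ^ n * (1ℚ + y * e)) (fromℕ-+ 1 n) ⟩
  x * x ^ n * (1ℚ + (1ℚ + fromℕ n) * e)
    ≡⟨ solve 3 (λ x y z → x :* y :* z := y :* (x :* z)) refl x (x ^ n) _ ⟩
  x ^ n * (x * (1ℚ + (1ℚ + fromℕ n) * e))
    ≤⟨ ℚ.*-monoˡ-≤-nonNeg (x ^ n) {{^-nonNegative x n}} step ⟩
  x ^ n * (1ℚ + fromℕ n * e)
    ≤⟨ bernoulli x≤1-e n ⟩
  1ℚ ∎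
  where
  open ℚ.≤-Reasoning
  open +-*-Solver
  m = 1ℚ + fromℕ n
  me≥0 : ℚ.NonNegative (m * e)
  me≥0 = ℚ.nonNeg*nonNeg⇒nonNeg m {{ℚ.nonNeg+nonNeg⇒nonNeg 1ℚ (fromℕ n) {{fromℕ-nonNegative n}}}} e
  lost = m * e * e
  lost≥0 : 0ℚ ≤ lost
  lost≥0 = ℚ.nonNegative⁻¹ lost {{ℚ.nonNeg*nonNeg⇒nonNeg (m * e) {{me≥0}} e}}
  step : x * (1ℚ + m * e) ≤ 1ℚ + fromℕ n * e
  step = begin
    x * (1ℚ + m * e)
      ≤⟨ ℚ.*-monoʳ-≤-nonNeg (1ℚ + m * e) {{ℚ.nonNeg+nonNeg⇒nonNeg 1ℚ (m * e) {{me≥0}}}} x≤1-e ⟩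
    (1ℚ - e) * (1ℚ + m * e)
      ≡⟨ solve 2 (λ n e → (con 1ℚ :- e) :* (con 1ℚ :+ (con 1ℚ :+ n) :* e) :=
           con 1ℚ :+ n :* e :- (con 1ℚ :+ n) :* e :* e) refl (fromℕ n) e ⟩
    1ℚ + fromℕ n * e - lost
      ≤⟨ ℚ.+-monoʳ-≤ (1ℚ + fromℕ n * e) (ℚ.neg-antimono-≤ lost≥0) ⟩
    1ℚ + fromℕ n * e + 0ℚ
      ≡⟨ ℚ.+-identityʳ (1ℚ + fromℕ n * e) ⟩
    1ℚ + fromℕ n * e ∎

power≤¼ : ∀ {x e} .{{_ : ℚ.NonNegative x}} .{{_ : ℚ.NonNegative e}} → x ≤ 1ℚ - e →
  ∀ n → fromℕ 3 ≤ fromℕ n * e → x ^ n ≤ + 1 / 4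
power≤¼ {x} {e} x≤1-e n 3≤ne = ℚ.*-cancelʳ-≤-pos (fromℕ 4) (begin
  x ^ n * (1ℚ + fromℕ 3)      ≤⟨ ℚ.*-monoˡ-≤-nonNeg (x ^ n) {{^-nonNegative x n}} (ℚ.+-monoʳ-≤ 1ℚ 3≤ne) ⟩
  x ^ n * (1ℚ + fromℕ n * e)  ≤⟨ bernoulli x≤1-e n ⟩
  1ℚ                          ∎)
  where open ℚ.≤-Reasoning

-- The program

-- The registers:
--   0  the verdict, after the setup: positive as long as no clause has been
--      found false
--   1  the length n of the input
--   2  the number of rounds that remain
--   3  the cursor, an address in the input
--   4  the address of the variable of the literal at the cursor
--   5  scratch; finally 1 or 0 as the literal at the cursor is true or false
--   6  the number of true literals seen in the current clause
--   7  scratch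
-- The value of variable i, as 0 or 1, is kept in memory at address n + 1 + i.

-- Addresses 0, 1 and 2 hold the numerator and the denominator of ε and the
-- number of variables; the clauses start at address 3.
rewind advance : Program
rewind  = $ 3 ≔ # 3 ⟨ add ⟩ # 0 ∷ []
advance = $ 3 ≔ ! $ 3 ⟨ add ⟩ # 1 ∷ []

-- The codes 1 + 2i and 2 + 2i of the literals of variable i satisfy
-- ⌊(code + 1) / 2⌋ = 1 + i.
locate : Program
locate  = $ 4 ≔ ! M[ 3 ] ⟨ add ⟩ # 1
        ∷ $ 4 ≔ ! $ 4 ⟨ div ⟩ # 2
        ∷ $ 4 ≔ ! $ 1 ⟨ add ⟩ ! $ 4
        ∷ []

-- The code of a literal is odd when the literal is positive, so the literal is
-- true exactly when the sum of its code and the value of its variable is even.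
addTruth : Program
addTruth = $ 5 ≔ ! M[ 3 ] ⟨ add ⟩ ! M[ 4 ]
         ∷ $ 7 ≔ ! $ 5 ⟨ div ⟩ # 2
         ∷ $ 7 ≔ ! $ 7 ⟨ mul ⟩ # 2
         ∷ $ 5 ≔ ! $ 5 ⟨ sub ⟩ ! $ 7
         ∷ $ 5 ≔ # 1 ⟨ sub ⟩ ! $ 5
         ∷ $ 6 ≔ ! $ 6 ⟨ add ⟩ ! $ 5
         ∷ []

clearFlag closeClause countRound : Program
clearFlag   = $ 6 ≔ # 0 ⟨ add ⟩ # 0 ∷ []
closeClause = $ 0 ≔ ! $ 0 ⟨ mul ⟩ ! $ 6 ∷ clearFlag
countRound  = $ 2 ≔ ! $ 2 ⟨ sub ⟩ # 1 ∷ []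

-- The loops over literals stop at the 0 that terminates a clause; the loops
-- over clauses stop at the end of the input.
tossLiterals tossClauses evalLiterals evalClauses rounds : Command
tossLiterals = while # 0 < ! M[ 3 ] loop (locate ++ toss M[ 4 ] ∷ advance)
tossClauses  = while ! $ 3 < ! $ 1 loop (tossLiterals ∷ advance)
evalLiterals = while # 0 < ! M[ 3 ] loop (locate ++ addTruth ++ advance)
evalClauses  = while ! $ 3 < ! $ 1 loop (evalLiterals ∷ closeClause ++ advance)
rounds       = while # 0 < ! $ 2 loop
  (rewind ++ tossClauses ∷ rewind ++ clearFlag ++ evalClauses ∷ countRound)

-- For ε = p/q, the number of rounds is set to ⌊3q/p⌋ + 1.
setup : Program
setup =
    $ 1 ≔ ! $ 0 ⟨ add ⟩ # 0
  ∷ $ 3 ≔ # 1 ⟨ add ⟩ # 0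
  ∷ $ 2 ≔ # 3 ⟨ mul ⟩ ! M[ 3 ]
  ∷ $ 3 ≔ # 0 ⟨ add ⟩ # 0
  ∷ $ 2 ≔ ! $ 2 ⟨ div ⟩ ! M[ 3 ]
  ∷ $ 2 ≔ ! $ 2 ⟨ add ⟩ # 1
  ∷ $ 0 ≔ # 1 ⟨ add ⟩ # 0
  ∷ []

tautologyTest : Program
tautologyTest = setup ++ rounds ∷ []

-- A logic for programs

-- Started in s, the program p halts within t steps under every sequence of coin
-- outcomes, and it answers True with probability x.
record Accepts (x : ℚ) (t : ℕ) (p : Program) (s : State) : Set where
  constructor accepts
  field
    halting     : HaltsWithin t p s
    probability : Prob answer (run t p s) ≡ x

module _ {s : State} {t : ℕ} {cs : Program} where

  assign : ∀ {x p a o b} → Accepts x t cs (write s p (apply o (value s a) (value s b))) →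
           Accepts x (suc t) (p ≔ a ⟨ o ⟩ b ∷ cs) s
  assign (accepts h p) = accepts h p

  flip : ∀ {x y p} → Accepts x t cs (write s p 0) → Accepts y t cs (write s p 1) →
         Accepts (mid x y) (suc t) (toss p ∷ cs) s
  flip (accepts h p) (accepts h′ p′) = accepts (h , h′) (cong₂ mid p p′)

  enter : ∀ {x a b c} → (value s a <ᵇ value s b) ≡ true →
          Accepts x t (c ++ (while a < b loop c) ∷ cs) s →
          Accepts x (suc t) ((while a < b loop c) ∷ cs) s
  enter {x} {a} {b} {c} eq (accepts h p) =
    accepts (subst (Always (λ _ → ⊤)) taken h) (trans (cong (Prob answer) (sym taken)) p)
    where
    taken : run t (c ++ (while a < b loop c) ∷ cs) s ≡ run (suc t) ((while a < b loop c) ∷ cs) s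
    taken rewrite eq = refl

  leave : ∀ {x a b c} → (value s a <ᵇ value s b) ≡ false → Accepts x t cs s →
          Accepts x (suc t) ((while a < b loop c) ∷ cs) s
  leave {x} {a} {b} {c} eq (accepts h p) =
    accepts (subst (Always (λ _ → ⊤)) left h) (trans (cong (Prob answer) (sym left)) p)
    where
    left : run t cs s ≡ run (suc t) ((while a < b loop c) ∷ cs) s
    left rewrite eq = refl

-- A program that consists of assignments only.
Straight : Program → Set
Straight []                  = ⊤
Straight (_ ≔ _ ⟨ _ ⟩ _ ∷ p) = Straight p
Straight (_ ∷ p)             = ⊥

-- The state after a program that consists of assignments only.
exec : ∀ p {_ : Straight p} → State → State
exec []                      s = s
exec (p ≔ a ⟨ o ⟩ b ∷ cs) {h} s = exec cs {h} (write s p (apply o (value s a) (value s b)))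

execute : ∀ p {h : Straight p} {x t cs s} → Accepts x t cs (exec p {h} s) →
          Accepts x (length p ℕ.+ t) (p ++ cs) s
execute []                            acc = acc
execute (p ≔ a ⟨ o ⟩ b ∷ cs) {h} acc = assign (execute cs {h} acc)

-- Memory, the written form, and the truth of literals

update-same : ∀ f a v → update f a v a ≡ v
update-same f a v with a ≡ᵇ a | ℕ.≡⇒≡ᵇ a a refl
... | true | _ = refl

update-other : ∀ f {a b} v → b ≢ a → update f a v b ≡ f b
update-other f {a} {b} v b≢a with b ≡ᵇ a | ℕ.≡ᵇ⇒≡ b a
... | true  | eq with () ← b≢a (eq tt)
... | false | _  = refl

drop-inside : ∀ a (xs ys : List ℕ) {z zs} → drop a xs ≡ ys ++ z ∷ zs → (a <ᵇ length xs) ≡ true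
drop-inside zero    []       []       ()
drop-inside zero    []       (_ ∷ _)  ()
drop-inside zero    (_ ∷ _)  ys       eq = refl
drop-inside (suc a) []       []       ()
drop-inside (suc a) []       (_ ∷ _)  ()
drop-inside (suc a) (_ ∷ xs) ys       eq = drop-inside a xs ys eq

drop-outside : ∀ a (xs : List ℕ) → drop a xs ≡ [] → (a <ᵇ length xs) ≡ false
drop-outside zero    []       eq = refl
drop-outside (suc a) []       eq = refl
drop-outside (suc a) (_ ∷ xs) eq = drop-outside a xs eq

cell-drop : ∀ a xs {y ys} → drop a xs ≡ y ∷ ys → cell xs a ≡ y
cell-drop zero    (_ ∷ _)  refl = refl
cell-drop (suc a) (_ ∷ xs) eq   = cell-drop a xs eq

drop-suc : ∀ a (xs : List ℕ) {y ys} → drop a xs ≡ y ∷ ys → drop (suc a) xs ≡ ys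
drop-suc zero    (_ ∷ _)  refl = refl
drop-suc (suc a) (_ ∷ xs) eq   = drop-suc a xs eq

cell-outside : ∀ xs a → cell xs (length xs ℕ.+ a) ≡ 0
cell-outside []       a = refl
cell-outside (_ ∷ xs) a = cell-outside xs a

-- The representation of a truth value in a memory cell.
bit : Bool → ℕ
bit b = if b then 1 else 0

positive-+ : ∀ m n → (0 <ᵇ m ℕ.+ n) ≡ (0 <ᵇ m) ∨ (0 <ᵇ n)
positive-+ zero    n = refl
positive-+ (suc m) n = refl

positive-* : ∀ m n → (0 <ᵇ m ℕ.* n) ≡ (0 <ᵇ m) ∧ (0 <ᵇ n)
positive-* zero    n       = refl
positive-* (suc m) (suc n) = refl
positive-* (suc m) zero    = cong (0 <ᵇ_) (ℕ.*-zeroʳ m)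

positive-encodeLiteral : ∀ {k} (l : Literal k) → (0 <ᵇ encodeLiteral l) ≡ true
positive-encodeLiteral (pos i) = refl
positive-encodeLiteral (neg i) = refl

encodeLiteral-var : ∀ {k} (l : Literal k) → (encodeLiteral l ℕ.+ 1) ℕ./ 2 ≡ suc (toℕ (var l))
encodeLiteral-var (pos i) = begin
  (1 ℕ.+ 2 ℕ.* toℕ i ℕ.+ 1) ℕ./ 2     ≡⟨ cong (ℕ._/ 2) (eq (toℕ i)) ⟩
  suc (toℕ i) ℕ.* 2 ℕ./ 2             ≡⟨ ℕ.m*n/n≡m (suc (toℕ i)) 2 ⟩
  suc (toℕ i)                         ∎
  where
  open ≡-Reasoning
  eq : ∀ j → 1 ℕ.+ 2 ℕ.* j ℕ.+ 1 ≡ suc j ℕ.* 2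
  eq = solve-∀
encodeLiteral-var (neg i) = begin
  (2 ℕ.+ 2 ℕ.* toℕ i ℕ.+ 1) ℕ./ 2     ≡⟨ cong (ℕ._/ 2) (eq (toℕ i)) ⟩
  (1 ℕ.+ suc (toℕ i) ℕ.* 2) ℕ./ 2     ≡⟨ ℕ.+-distrib-/ 1 (suc (toℕ i) ℕ.* 2) (rem (suc (toℕ i))) ⟩
  suc (toℕ i) ℕ.* 2 ℕ./ 2             ≡⟨ ℕ.m*n/n≡m (suc (toℕ i)) 2 ⟩
  suc (toℕ i)                         ∎
  where
  open ≡-Reasoning
  eq : ∀ j → 2 ℕ.+ 2 ℕ.* j ℕ.+ 1 ≡ 1 ℕ.+ suc j ℕ.* 2
  eq = solve-∀
  rem : ∀ j → 1 ℕ.+ (j ℕ.* 2) ℕ.% 2 ℕ.< 2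
  rem j = ℕ.≤-reflexive (cong (2 ℕ.+_) (ℕ.m*n%n≡0 j 2))

-- The result of the parity computation on the code of a literal and the value of
-- its variable.
literal-truth : ∀ {k} (σ : Assignment k) l →
  let x = encodeLiteral l ℕ.+ bit (lookup σ (var l)) in
  1 ℕ.∸ (x ℕ.∸ (x ℕ./ 2) ℕ.* 2) ≡ bit (satLiteral σ l)
literal-truth σ l =
  trans (cong (1 ℕ.∸_) (sym (ℕ.m%n≡m∸m/n*n (encodeLiteral l ℕ.+ bit (lookup σ (var l))) 2)))
        (parity l)
  where
  remainder : ∀ c j {x} → x ≡ c ℕ.+ j ℕ.* 2 → 1 ℕ.∸ x ℕ.% 2 ≡ 1 ℕ.∸ c ℕ.% 2
  remainder c j refl = cong (1 ℕ.∸_) (ℕ.[m+kn]%n≡m%n c j 2)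
  parity : ∀ l → 1 ℕ.∸ (encodeLiteral l ℕ.+ bit (lookup σ (var l))) ℕ.% 2 ≡ bit (satLiteral σ l)
  parity (pos i) with lookup σ i
  ... | true  = remainder 0 (suc (toℕ i)) (eq (toℕ i))
    where eq : ∀ j → 1 ℕ.+ 2 ℕ.* j ℕ.+ 1 ≡ 0 ℕ.+ suc j ℕ.* 2
          eq = solve-∀
  ... | false = remainder 1 (toℕ i) (eq (toℕ i))
    where eq : ∀ j → 1 ℕ.+ 2 ℕ.* j ℕ.+ 0 ≡ 1 ℕ.+ j ℕ.* 2
          eq = solve-∀
  parity (neg i) with lookup σ i
  ... | true  = remainder 1 (suc (toℕ i)) (eq (toℕ i))
    where eq : ∀ j → 2 ℕ.+ 2 ℕ.* j ℕ.+ 1 ≡ 1 ℕ.+ suc j ℕ.* 2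
          eq = solve-∀
  ... | false = remainder 0 (suc (toℕ i)) (eq (toℕ i))
    where eq : ∀ j → 2 ℕ.+ 2 ℕ.* j ℕ.+ 0 ≡ 0 ℕ.+ suc j ℕ.* 2
          eq = solve-∀

positive-bit : ∀ b → (0 <ᵇ bit b) ≡ b
positive-bit true  = refl
positive-bit false = refl

-- Execution times

-- The time taken by the loops, where t is the time taken by the rest of the
-- program, κ the cost of a literal (including the test of the loop), and π the
-- cost of the commands that close a clause.  A toss pass has κ = 6 and π = 1; an
-- evaluation pass has κ = 11 and π = 3.  A round has in addition its loop test, two
-- rewinds, the reset of the flag and the decrement of the round counter.
module _ {k : ℕ} where
  literalsTime : ℕ → Clause k → ℕ → ℕ
  literalsTime κ []      t = suc t
  literalsTime κ (_ ∷ c) t = κ ℕ.+ literalsTime κ c t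

  clausesTime : ℕ → ℕ → List (Clause k) → ℕ → ℕ
  clausesTime κ π []       t = suc t
  clausesTime κ π (c ∷ cs) t = suc (literalsTime κ c (π ℕ.+ clausesTime κ π cs t))

  roundsTime : List (Clause k) → ℕ → ℕ
  roundsTime cs zero    = 1
  roundsTime cs (suc m) =
    2 ℕ.+ clausesTime 6 1 cs (2 ℕ.+ clausesTime 11 3 cs (suc (roundsTime cs m)))

-- Correctness of the program

-- Executions on formulas with k variables, where W is the input.
module Execution (k : ℕ) (W : List ℕ) where

  -- The memory still holds the input, and it holds the assignment σ behind it.
  record Memory (σ : Assignment k) (f : ℕ → ℕ) : Set where
    field
      inputs : ∀ {a} → a ℕ.< length W → f a ≡ cell W a
      values : ∀ i → f (length W ℕ.+ suc (toℕ i)) ≡ bit (lookup σ i)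
  open Memory

  -- The invariant of all loops: m rounds remain, the answer would currently be v,
  -- the current assignment is σ, and the part xs of the input is still to be read.
  record At (m : ℕ) (v : Bool) (σ : Assignment k) (xs : List ℕ) (s : State) : Set where
    field
      bound     : reg s 1 ≡ length W
      remaining : reg s 2 ≡ m
      verdict   : answer s ≡ v
      memory    : Memory σ (mem s)
      cursor    : drop (reg s 3) W ≡ xs
  open At

  toss-memory : ∀ {σ f} i b → Memory σ f →
    Memory (σ [ i ]≔ b) (update f (length W ℕ.+ suc (toℕ i)) (bit b))
  toss-memory {σ} {f} i b h .inputs a<n =
    trans (update-other f (bit b) λ { refl → ℕ.m+n≮m (length W) (suc (toℕ i)) a<n }) (inputs h a<n)
  toss-memory {σ} {f} i b h .values j with j Fin.≟ i
  ... | yes refl = trans (update-same f (length W ℕ.+ suc (toℕ i)) (bit b))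
                         (cong bit (sym (Vec.lookup∘update i σ b)))
  ... | no j≢i   = trans (update-other f (bit b) λ eq →
                           j≢i (Fin.toℕ-injective (ℕ.suc-injective (ℕ.+-cancelˡ-≡ (length W) _ _ eq))))
                         (trans (values h j) (cong bit (sym (Vec.lookup∘update′ j≢i σ b))))

  inside : ∀ {m v σ s} ys {x xs} → At m v σ (ys ++ x ∷ xs) s → (reg s 3 <ᵇ reg s 1) ≡ true
  inside {s = s} ys h rewrite bound h = drop-inside (reg s 3) W ys (cursor h)

  outside : ∀ {m v σ s} → At m v σ [] s → (reg s 3 <ᵇ reg s 1) ≡ false
  outside {s = s} h rewrite bound h = drop-outside (reg s 3) W (cursor h)

  current : ∀ {m v σ x xs s} → At m v σ (x ∷ xs) s → mem s (reg s 3) ≡ x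
  current {s = s} h =
    trans (inputs (memory h) (ℕ.<ᵇ⇒< (reg s 3) (length W)
            (subst T (sym (drop-inside (reg s 3) W [] (cursor h))) tt)))
          (cell-drop (reg s 3) W (cursor h))

  next : ∀ {m v σ x xs s} → At m v σ (x ∷ xs) s → drop (reg s 3 ℕ.+ 1) W ≡ xs
  next {s = s} h rewrite ℕ.+-comm (reg s 3) 1 = drop-suc (reg s 3) W (cursor h)

  located : ∀ {m v σ xs s} (l : Literal k) → At m v σ (encodeLiteral l ∷ xs) s →
    reg s 1 ℕ.+ (mem s (reg s 3) ℕ.+ 1) ℕ./ 2 ≡ length W ℕ.+ suc (toℕ (var l))
  located l h = cong₂ ℕ._+_ (bound h)
    (trans (cong (λ x → (x ℕ.+ 1) ℕ./ 2) (current h)) (encodeLiteral-var l))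

  literal-next : ∀ {m v σ xs s} (l : Literal k) → At m v σ (encodeLiteral l ∷ xs) s →
                 (0 <ᵇ mem s (reg s 3)) ≡ true
  literal-next l h = trans (cong (0 <ᵇ_) (current h)) (positive-encodeLiteral l)

  -- The loop replaces the coordinates of the literals of c by coins; js stands for
  -- the tosses that the rest of the pass still makes.
  toss-literals : ∀ {m v t rest xs js} (g : Assignment k → ℚ) →
    (∀ τ s → At m v τ (0 ∷ xs) s → Accepts (toss-all js g τ) t rest s) →
    ∀ c σ s → At m v σ (map encodeLiteral c ++ 0 ∷ xs) s →
    Accepts (toss-all (map var c ++ js) g σ) (literalsTime 6 c t) (tossLiterals ∷ rest) s
  toss-literals g cont []      σ s h = leave (cong (0 <ᵇ_) (current h)) (cont σ s h)
  toss-literals {m} {v} {t} {rest} {xs} {js} g cont (l ∷ c) σ s h =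
    enter (literal-next l h) (execute locate
      (flip (execute advance (branch false)) (execute advance (branch true))))
    where
    branch : ∀ b → Accepts (toss-all (map var c ++ js) g (σ [ var l ]≔ b))
      (literalsTime 6 c t) (tossLiterals ∷ rest) (exec advance (write (exec locate s) M[ 4 ] (bit b)))
    branch b = toss-literals g cont c (σ [ var l ]≔ b) _ record
      { bound     = bound h
      ; remaining = remaining h
      ; verdict   = verdict h
      ; memory    = subst (λ a → Memory (σ [ var l ]≔ b) (update (mem s) a (bit b)))
                          (sym (located l h)) (toss-memory (var l) b (memory h))
      ; cursor    = next h
      }

  clauses-cursor : ∀ {m v σ s} c (cs : List (Clause k)) →
    At m v σ (concatMap encodeClause (c ∷ cs)) s →
    At m v σ (map encodeLiteral c ++ 0 ∷ concatMap encodeClause cs) s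
  clauses-cursor {m} {v} {σ} {s} c cs h = subst (λ xs → At m v σ xs s)
    (List.++-assoc (map encodeLiteral c) (0 ∷ []) (concatMap encodeClause cs)) h

  moved : ∀ {m v σ x xs s} → At m v σ (x ∷ xs) s → At m v σ xs (exec advance s)
  moved h = record
    { bound     = bound h
    ; remaining = remaining h
    ; verdict   = verdict h
    ; memory    = memory h
    ; cursor    = next h
    }

  toss-clauses : ∀ {m v t rest} (g : Assignment k → ℚ) →
    (∀ τ s → At m v τ [] s → Accepts (g τ) t rest s) →
    ∀ cs σ s → At m v σ (concatMap encodeClause cs) s →
    Accepts (toss-all (occurrences cs) g σ) (clausesTime 6 1 cs t) (tossClauses ∷ rest) s
  toss-clauses g cont []       σ s h = leave (outside h) (cont σ s h)
  toss-clauses g cont (c ∷ cs) σ s h =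
    enter (inside (map encodeLiteral c) h′)
      (toss-literals g (λ τ s h → execute advance (toss-clauses g cont cs τ _ (moved h))) c σ s h′)
    where h′ = clauses-cursor c cs h

  -- The flag f records whether an earlier literal of the clause is true.
  eval-literals : ∀ {x m v σ t rest xs} c f →
    (∀ s → At m v σ (0 ∷ xs) s → (0 <ᵇ reg s 6) ≡ f ∨ any (satLiteral σ) c → Accepts x t rest s) →
    ∀ s → At m v σ (map encodeLiteral c ++ 0 ∷ xs) s → (0 <ᵇ reg s 6) ≡ f →
    Accepts x (literalsTime 11 c t) (evalLiterals ∷ rest) s
  eval-literals []      f cont s h flag =
    leave (cong (0 <ᵇ_) (current h)) (cont s h (trans flag (sym (Bool.∨-identityʳ f))))
  eval-literals {m = m} {v} {σ} {xs = xs} (l ∷ c) f cont s h flag =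
    enter (literal-next l h)
      (execute (locate ++ addTruth ++ advance)
        (eval-literals c (f ∨ satLiteral σ l)
          (λ s h flag → cont s h (trans flag (Bool.∨-assoc f (satLiteral σ l) (any (satLiteral σ) c))))
          _ (moved scanned) flag′))
    where
    open ≡-Reasoning
    cell-sum : mem s (reg s 3) ℕ.+ mem s (reg s 1 ℕ.+ (mem s (reg s 3) ℕ.+ 1) ℕ./ 2) ≡
               encodeLiteral l ℕ.+ bit (lookup σ (var l))
    cell-sum = cong₂ ℕ._+_ (current h) (trans (cong (mem s) (located l h)) (values (memory h) (var l)))
    scanned : At m v σ (encodeLiteral l ∷ map encodeLiteral c ++ 0 ∷ xs) (exec (locate ++ addTruth) s)
    scanned = record
      { bound     = bound h
      ; remaining = remaining h
      ; verdict   = verdict h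
      ; memory    = memory h
      ; cursor    = cursor h
      }
    flag′ : (0 <ᵇ reg (exec (locate ++ addTruth) s) 6) ≡ f ∨ satLiteral σ l
    flag′ = begin
      (0 <ᵇ reg s 6 ℕ.+ _)
        ≡⟨ cong (λ x → 0 <ᵇ reg s 6 ℕ.+ (1 ℕ.∸ (x ℕ.∸ x ℕ./ 2 ℕ.* 2))) cell-sum ⟩
      (0 <ᵇ reg s 6 ℕ.+ _)
        ≡⟨ cong (λ x → 0 <ᵇ reg s 6 ℕ.+ x) (literal-truth σ l) ⟩
      (0 <ᵇ reg s 6 ℕ.+ bit (satLiteral σ l))
        ≡⟨ positive-+ (reg s 6) (bit (satLiteral σ l)) ⟩
      (0 <ᵇ reg s 6) ∨ (0 <ᵇ bit (satLiteral σ l))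
        ≡⟨ cong₂ _∨_ flag (positive-bit (satLiteral σ l)) ⟩
      f ∨ satLiteral σ l ∎

  eval-clauses : ∀ {x m v σ t rest} cs →
    (∀ s → At m (v ∧ all (any (satLiteral σ)) cs) σ [] s → Accepts x t rest s) →
    ∀ s → At m v σ (concatMap encodeClause cs) s → (0 <ᵇ reg s 6) ≡ false →
    Accepts x (clausesTime 11 3 cs t) (evalClauses ∷ rest) s
  eval-clauses {m = m} {v} {σ} [] cont s h flag =
    leave (outside h) (cont s (subst (λ v → At m v σ [] s) (sym (Bool.∧-identityʳ v)) h))
  eval-clauses {m = m} {v} {σ} (c ∷ cs) cont s h flag =
    enter (inside (map encodeLiteral c) h′)
      (eval-literals c false (λ s h flag → execute (closeClause ++ advance)
        (eval-clauses cs
          (λ s h → cont s (subst (λ v → At m v σ [] s)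
                                 (Bool.∧-assoc v (any (satLiteral σ) c) (all (any (satLiteral σ)) cs)) h))
          _ (moved (closed s h flag)) refl))
        s h′ flag)
    where
    h′ = clauses-cursor c cs h
    closed : ∀ {xs} s → At m v σ (0 ∷ xs) s → (0 <ᵇ reg s 6) ≡ any (satLiteral σ) c →
             At m (v ∧ any (satLiteral σ) c) σ (0 ∷ xs) (exec closeClause s)
    closed s h flag = record
      { bound     = bound h
      ; remaining = remaining h
      ; verdict   = trans (positive-* (reg s 0) (reg s 6)) (cong₂ _∧_ (verdict h) flag)
      ; memory    = memory h
      ; cursor    = cursor h
      }

  -- The clauses cs are written in W from address 3 on.
  module Rounds (cs : List (Clause k)) (layout : drop 3 W ≡ concatMap encodeClause cs) where

    sat : Assignment k → Bool
    sat σ = all (any (satLiteral σ)) cs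

    -- The probability of answering True when m rounds remain and the answer would
    -- currently be v.
    acceptance : Bool → ℕ → ℚ
    acceptance v m = if v then avg (indicator ∘ sat) ^ m else 0ℚ

    -- One round multiplies the probability of acceptance by that of a satisfying
    -- sample, and a False verdict is final.
    round-acceptance : ∀ v m σ →
      toss-all (occurrences cs) (λ τ → acceptance (v ∧ sat τ) m) σ ≡ acceptance v (suc m)
    round-acceptance v m σ =
      trans (toss-all-avg (occurrences cs) _
              (λ σ τ agree → cong (λ b → acceptance (v ∧ b) m) (all-dependsOn cs σ τ agree)) σ)
            (average v)
      where
      average : ∀ v → avg (λ τ → acceptance (v ∧ sat τ) m) ≡ acceptance v (suc m)
      average false = avg-const {k} 0ℚ
      average true  = trans (avg-cong (λ τ → scale (sat τ)))
                            (avg-* (indicator ∘ sat) (avg (indicator ∘ sat) ^ m))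
        where
        scale : ∀ b → acceptance b m ≡ indicator b * avg (indicator ∘ sat) ^ m
        scale true  = sym (ℚ.*-identityˡ _)
        scale false = sym (ℚ.*-zeroˡ (avg (indicator ∘ sat) ^ m))

    rewound : ∀ {m v σ xs s} → At m v σ xs s → At m v σ (concatMap encodeClause cs) (exec rewind s)
    rewound h = record
      { bound     = bound h
      ; remaining = remaining h
      ; verdict   = verdict h
      ; memory    = memory h
      ; cursor    = layout
      }

    run-rounds : ∀ m v σ xs s → At m v σ xs s →
                 Accepts (acceptance v m) (roundsTime cs m) (rounds ∷ []) s
    run-rounds zero    v σ xs s h = leave (cong (0 <ᵇ_) (remaining h))
      (accepts tt (trans (cong indicator (verdict h)) (zero-rounds v)))
      where
      zero-rounds : ∀ v → indicator v ≡ acceptance v 0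
      zero-rounds true  = refl
      zero-rounds false = refl
    run-rounds (suc m) v σ xs s h = enter (cong (0 <ᵇ_) (remaining h))
      (execute rewind (subst (λ x → Accepts x _ _ (exec rewind s)) (round-acceptance v m σ)
        (toss-clauses (λ τ → acceptance (v ∧ sat τ) m)
          (λ τ s h → execute (rewind ++ clearFlag) (eval-clauses cs
            (λ s h → execute countRound (run-rounds m (v ∧ sat τ) τ [] _ (counted h)))
            _ (cleared (rewound h)) refl))
          cs σ _ (rewound h))))
      where
      cleared : ∀ {m v σ xs s} → At m v σ xs s → At m v σ xs (exec clearFlag s)
      cleared h = record
        { bound     = bound h
        ; remaining = remaining h
        ; verdict   = verdict h
        ; memory    = memory h
        ; cursor    = cursor h
        }
      counted : ∀ {v σ xs s} → At (suc m) v σ xs s → At m v σ xs (exec countRound s)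
      counted h = record
        { bound     = bound h
        ; remaining = cong (ℕ._∸ 1) (remaining h)
        ; verdict   = verdict h
        ; memory    = memory h
        ; cursor    = cursor h
        }

-- Probabilities of events in a halting computation

Prob≤1 : ∀ P r → Prob P r ≤ 1ℚ
Prob≤1 P (halted s) with P s
... | true  = ℚ.≤-refl
... | false = ℚ.nonNegative⁻¹ 1ℚ
Prob≤1 P timeout    = ℚ.nonNegative⁻¹ 1ℚ
Prob≤1 P (coin l r) = ℚ.+-mono-≤ (ℚ.*-monoˡ-≤-nonNeg ½ (Prob≤1 P l)) (ℚ.*-monoˡ-≤-nonNeg ½ (Prob≤1 P r))

mid≡1 : ∀ {x y} → y ≤ 1ℚ → x ≤ 1ℚ → mid x y ≡ 1ℚ → x ≡ 1ℚ
mid≡1 {x} {y} y≤1 x≤1 eq = ℚ.≤-antisym x≤1 (begin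
  1ℚ                   ≡⟨⟩
  fromℕ 2 * 1ℚ - 1ℚ    ≤⟨ ℚ.+-monoʳ-≤ (fromℕ 2 * 1ℚ) (ℚ.neg-antimono-≤ y≤1) ⟩
  fromℕ 2 * 1ℚ - y     ≡⟨ cong (λ z → fromℕ 2 * z - y) (sym eq) ⟩
  fromℕ 2 * mid x y - y
    ≡⟨ solve 2 (λ x y → con (fromℕ 2) :* (con ½ :* x :+ con ½ :* y) :- y := x) refl x y ⟩
  x ∎)
  where
  open ℚ.≤-Reasoning
  open +-*-Solver

Prob≡1⇒Always : ∀ P r → Prob P r ≡ 1ℚ → Always (λ s → P s ≡ true) r
Prob≡1⇒Always P (halted s) eq with P s
... | true = refl
Prob≡1⇒Always P (coin l r) eq =
  Prob≡1⇒Always P l (mid≡1 (Prob≤1 P r) (Prob≤1 P l) eq) ,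
  Prob≡1⇒Always P r (mid≡1 (Prob≤1 P l) (Prob≤1 P r) (trans (mid-comm (Prob P r) (Prob P l)) eq))

Prob-not : ∀ P r → Always (λ _ → ⊤) r → Prob (not ∘ P) r ≡ 1ℚ - Prob P r
Prob-not P (halted s) h with P s
... | true  = refl
... | false = refl
Prob-not P (coin l r) (hl , hr) =
  trans (cong₂ mid (Prob-not P l hl) (Prob-not P r hr))
        (solve 2 (λ x y → con ½ :* (con 1ℚ :- x) :+ con ½ :* (con 1ℚ :- y) :=
                          con 1ℚ :- (con ½ :* x :+ con ½ :* y)) refl (Prob P l) (Prob P r))
  where open +-*-Solver

-- The number of samples

-- The numerator and the denominator of ε, and the number of rounds that the
-- program performs.
numerator denominator samples : Tolerance → ℕ
numerator t   = ∣ ↥ ε t ∣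
denominator t = ↧ₙ ε t
samples t     = apply div (3 ℕ.* denominator t) (numerator t) ℕ.+ 1

numerator-nonZero : ∀ t → ℕ.NonZero (numerator t)
numerator-nonZero (tolerance (mkℚ +[1+ p ] _ _) _ _) = _
numerator-nonZero (tolerance (mkℚ (+ 0) _ _) (*<* (ℤ.+<+ ())) _)
numerator-nonZero (tolerance (mkℚ -[1+ _ ] _ _) (*<* ()) _)

ε*denominator : ∀ t → ε t * fromℕ (denominator t) ≡ fromℕ (numerator t)
ε*denominator (tolerance e@(mkℚ (+ p) d _) _ _) =
  trans (cong (_* fromℕ (suc d)) (sym (ℚ.↥p/↧p≡p e))) (/-*-cancel p (suc d))
ε*denominator (tolerance (mkℚ -[1+ _ ] _ _) (*<* ()) _)

numerator≤denominator : ∀ t → numerator t ℕ.≤ denominator t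
numerator≤denominator (tolerance (mkℚ (+ p) d _) _ (*<* p<d)) =
  ℕ.<⇒≤ (ℤ.drop‿+<+ (subst₂ ℤ._<_ (ℤ.*-identityʳ (+ p)) (ℤ.*-identityˡ (+ suc d)) p<d))
numerator≤denominator (tolerance (mkℚ -[1+ _ ] _ _) (*<* ()) _)

-- Both bounds hold because n = ⌊3q/p⌋ + 1 satisfies 3q < np ≤ 3q + p.
samples-bounds : ∀ p q → .{{_ : ℕ.NonZero p}} → p ℕ.≤ q → let n = apply div (3 ℕ.* q) p ℕ.+ 1 in
  3 ℕ.* q ℕ.≤ n ℕ.* p × n ℕ.* p ℕ.≤ 4 ℕ.* q
samples-bounds p@(suc _) q p≤q = lower , upper
  where
  open ℕ.≤-Reasoning
  a = 3 ℕ.* q ℕ./ p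
  eq : ∀ a p → (a ℕ.+ 1) ℕ.* p ≡ p ℕ.+ a ℕ.* p
  eq = solve-∀
  lower : 3 ℕ.* q ℕ.≤ (a ℕ.+ 1) ℕ.* p
  lower = begin
    3 ℕ.* q                            ≡⟨ ℕ.m≡m%n+[m/n]*n (3 ℕ.* q) p ⟩
    (3 ℕ.* q) ℕ.% p ℕ.+ a ℕ.* p        ≤⟨ ℕ.+-monoˡ-≤ (a ℕ.* p) (ℕ.m%n≤n (3 ℕ.* q) p) ⟩
    p ℕ.+ a ℕ.* p                      ≡⟨ eq a p ⟨
    (a ℕ.+ 1) ℕ.* p                    ∎
  upper : (a ℕ.+ 1) ℕ.* p ℕ.≤ 4 ℕ.* q
  upper = begin
    (a ℕ.+ 1) ℕ.* p                    ≡⟨ eq a p ⟩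
    p ℕ.+ a ℕ.* p                      ≤⟨ ℕ.+-mono-≤ p≤q (ℕ.m/n*n≤m (3 ℕ.* q) p) ⟩
    4 ℕ.* q                            ∎

module _ (t : Tolerance) where
  private
    p = numerator t
    q = denominator t
    n = samples t

    bounds : 3 ℕ.* q ℕ.≤ n ℕ.* p × n ℕ.* p ℕ.≤ 4 ℕ.* q
    bounds = samples-bounds p q {{numerator-nonZero t}} (numerator≤denominator t)

    scaled : fromℕ (n ℕ.* p) ≡ fromℕ n * ε t * fromℕ q
    scaled = begin
      fromℕ (n ℕ.* p)              ≡⟨ fromℕ-* n p ⟩
      fromℕ n * fromℕ p            ≡⟨ cong (fromℕ n *_) (ε*denominator t) ⟨
      fromℕ n * (ε t * fromℕ q)    ≡⟨ ℚ.*-assoc (fromℕ n) (ε t) (fromℕ q) ⟨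
      fromℕ n * ε t * fromℕ q      ∎
      where open ≡-Reasoning

  -- The constant 3 makes 1 + nε at least 4.
  samples-sufficient : fromℕ 3 ≤ fromℕ n * ε t
  samples-sufficient = ℚ.*-cancelʳ-≤-pos (fromℕ q) {{fromℕ-positive q}} (begin
    fromℕ 3 * fromℕ q          ≡⟨ fromℕ-* 3 q ⟨
    fromℕ (3 ℕ.* q)            ≤⟨ fromℕ-mono-≤ (proj₁ bounds) ⟩
    fromℕ (n ℕ.* p)            ≡⟨ scaled ⟩
    fromℕ n * ε t * fromℕ q    ∎)
    where open ℚ.≤-Reasoning

  samples≤4/ε : fromℕ n ≤ fromℕ 4 * 1/ε t
  samples≤4/ε = ℚ.*-cancelʳ-≤-pos (ε t) {{ℚ.positive (0<ε t)}} (begin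
    fromℕ n * ε t              ≤⟨ ℚ.*-cancelʳ-≤-pos (fromℕ q) {{fromℕ-positive q}} cleared ⟩
    fromℕ 4                    ≡⟨ ℚ.*-identityʳ (fromℕ 4) ⟨
    fromℕ 4 * 1ℚ               ≡⟨ cong (fromℕ 4 *_) (ℚ.*-inverseˡ (ε t) {{ℚ.>-nonZero (0<ε t)}}) ⟨
    fromℕ 4 * (1/ε t * ε t)    ≡⟨ ℚ.*-assoc (fromℕ 4) (1/ε t) (ε t) ⟨
    fromℕ 4 * 1/ε t * ε t      ∎)
    where
    open ℚ.≤-Reasoning
    cleared : fromℕ n * ε t * fromℕ q ≤ fromℕ 4 * fromℕ q
    cleared = begin
      fromℕ n * ε t * fromℕ q  ≡⟨ scaled ⟨
      fromℕ (n ℕ.* p)          ≤⟨ fromℕ-mono-≤ (proj₂ bounds) ⟩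
      fromℕ (4 ℕ.* q)          ≡⟨ fromℕ-* 4 q ⟩
      fromℕ 4 * fromℕ q        ∎

-- The run on an encoded formula

-- A budget that suffices for every sequence of coin outcomes; the 7 is the
-- number of commands in the setup.
timeNeeded : CNF → Tolerance → ℕ
timeNeeded α t = 7 ℕ.+ roundsTime (clauses α) (samples t)

-- Initially all variables hold 0, which represents the value False.
run-tautologyTest : ∀ α t →
  Accepts (𝖡 α ^ samples t) (timeNeeded α t) tautologyTest (input α t)
run-tautologyTest α t = execute setup
  (subst (λ x → Accepts (x ^ samples t) (roundsTime (clauses α) (samples t)) (rounds ∷ [])
                        (exec setup (input α t)))
    (sym (𝖡≡avg α))
    (run-rounds (samples t) true (replicate (vars α) false) W _ started))
  where
  W : List ℕ
  W = numerator t ∷ denominator t ∷ encode α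
  open Execution (vars α) W
  open Rounds (clauses α) refl
  started : At (samples t) true (replicate (vars α) false) W (exec setup (input α t))
  started = record
    { bound     = ℕ.+-identityʳ (length W)
    ; remaining = refl
    ; verdict   = refl
    ; memory    = record
      { inputs = λ _ → refl
      ; values = λ i → trans (cell-outside W (suc (toℕ i))) (cong bit (sym (Vec.lookup-replicate i false)))
      }
    ; cursor    = refl
    }

-- Bounds on the execution time

module _ {k : ℕ} where
  literalsTime-≡ : ∀ κ (c : Clause k) t → literalsTime κ c t ≡ κ ℕ.* length c ℕ.+ suc t
  literalsTime-≡ κ []      t = cong (ℕ._+ suc t) (sym (ℕ.*-zeroʳ κ))
  literalsTime-≡ κ (_ ∷ c) t = trans (cong (κ ℕ.+_) (literalsTime-≡ κ c t)) (eq κ (length c) (suc t))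
    where
    eq : ∀ κ n t → κ ℕ.+ (κ ℕ.* n ℕ.+ t) ≡ κ ℕ.* suc n ℕ.+ t
    eq = solve-∀

  -- A clause costs κ for each literal, 2 for the tests that enter the clause and
  -- find its end, and π; the last two are charged to the terminating 0.
  clausesTime-≤ : ∀ κ π → 2 ℕ.+ π ℕ.≤ κ → ∀ (cs : List (Clause k)) t →
    clausesTime κ π cs t ℕ.≤ κ ℕ.* length (concatMap encodeClause cs) ℕ.+ suc t
  clausesTime-≤ κ π le []       t = ℕ.m≤n+m (suc t) (κ ℕ.* 0)
  clausesTime-≤ κ π le (c ∷ cs) t = begin
    suc (literalsTime κ c (π ℕ.+ clausesTime κ π cs t))
      ≡⟨ cong suc (literalsTime-≡ κ c (π ℕ.+ clausesTime κ π cs t)) ⟩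
    suc (κ ℕ.* length c ℕ.+ suc (π ℕ.+ clausesTime κ π cs t))
      ≡⟨ eq₁ (κ ℕ.* length c) π (clausesTime κ π cs t) ⟩
    (2 ℕ.+ π) ℕ.+ (κ ℕ.* length c ℕ.+ clausesTime κ π cs t)
      ≤⟨ ℕ.+-mono-≤ le (ℕ.+-monoʳ-≤ (κ ℕ.* length c) (clausesTime-≤ κ π le cs t)) ⟩
    κ ℕ.+ (κ ℕ.* length c ℕ.+ (κ ℕ.* length ys ℕ.+ suc t))
      ≡⟨ eq₂ κ (length c) (length ys) (suc t) ⟩
    κ ℕ.* ((length c ℕ.+ 1) ℕ.+ length ys) ℕ.+ suc t
      ≡⟨ cong (λ n → κ ℕ.* n ℕ.+ suc t) len ⟨
    κ ℕ.* length (encodeClause c ++ ys) ℕ.+ suc t ∎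
    where
    open ℕ.≤-Reasoning
    ys = concatMap encodeClause cs
    eq₁ : ∀ a π b → suc (a ℕ.+ suc (π ℕ.+ b)) ≡ (2 ℕ.+ π) ℕ.+ (a ℕ.+ b)
    eq₁ = solve-∀
    eq₂ : ∀ κ c y t → κ ℕ.+ (κ ℕ.* c ℕ.+ (κ ℕ.* y ℕ.+ t)) ≡ κ ℕ.* ((c ℕ.+ 1) ℕ.+ y) ℕ.+ t
    eq₂ = solve-∀
    len : length (encodeClause c ++ ys) ≡ (length c ℕ.+ 1) ℕ.+ length ys
    len = trans (List.length-++ (encodeClause c)) (cong (ℕ._+ length ys)
      (trans (List.length-++ (map encodeLiteral c)) (cong (ℕ._+ 1) (List.length-map encodeLiteral c))))

roundsTime-≤ : ∀ α m → roundsTime (clauses α) m ℕ.≤ m ℕ.* (17 ℕ.* size α) ℕ.+ 1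
roundsTime-≤ α zero    = ℕ.≤-refl
roundsTime-≤ α (suc m) = begin
  2 ℕ.+ clausesTime 6 1 cs (2 ℕ.+ clausesTime 11 3 cs (suc r))
    ≤⟨ ℕ.+-monoʳ-≤ 2 (clausesTime-≤ 6 1 (ℕ.m≤m+n 3 3) cs _) ⟩
  2 ℕ.+ (6 ℕ.* l ℕ.+ suc (2 ℕ.+ clausesTime 11 3 cs (suc r)))
    ≤⟨ ℕ.+-monoʳ-≤ 2 (ℕ.+-monoʳ-≤ (6 ℕ.* l) (ℕ.+-monoʳ-≤ 3 (clausesTime-≤ 11 3 (ℕ.m≤m+n 5 6) cs (suc r)))) ⟩
  2 ℕ.+ (6 ℕ.* l ℕ.+ (3 ℕ.+ (11 ℕ.* l ℕ.+ suc (suc r))))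
    ≡⟨ eq₁ l r ⟩
  (7 ℕ.+ 17 ℕ.* l) ℕ.+ r
    ≤⟨ ℕ.+-mono-≤ (ℕ.+-monoˡ-≤ (17 ℕ.* l) (ℕ.m≤m+n 7 10)) (roundsTime-≤ α m) ⟩
  (17 ℕ.+ 17 ℕ.* l) ℕ.+ (m ℕ.* (17 ℕ.* suc l) ℕ.+ 1)
    ≡⟨ eq₂ l m ⟩
  suc m ℕ.* (17 ℕ.* suc l) ℕ.+ 1 ∎
  where
  open ℕ.≤-Reasoning
  cs = clauses α
  l = length (concatMap encodeClause cs)
  r = roundsTime cs m
  eq₁ : ∀ l r → 2 ℕ.+ (6 ℕ.* l ℕ.+ (3 ℕ.+ (11 ℕ.* l ℕ.+ suc (suc r)))) ≡ (7 ℕ.+ 17 ℕ.* l) ℕ.+ r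
  eq₁ = solve-∀
  eq₂ : ∀ l m → (17 ℕ.+ 17 ℕ.* l) ℕ.+ (m ℕ.* (17 ℕ.* suc l) ℕ.+ 1) ≡ suc m ℕ.* (17 ℕ.* suc l) ℕ.+ 1
  eq₂ = solve-∀

timeNeeded-≤ : ∀ α t → timeNeeded α t ℕ.≤ 25 ℕ.* (samples t ℕ.* size α)
timeNeeded-≤ α t = begin
  7 ℕ.+ roundsTime (clauses α) n             ≤⟨ ℕ.+-monoʳ-≤ 7 (roundsTime-≤ α n) ⟩
  7 ℕ.+ (n ℕ.* (17 ℕ.* size α) ℕ.+ 1)        ≡⟨ eq₁ n (size α) ⟩
  8 ℕ.* 1 ℕ.+ 17 ℕ.* (n ℕ.* size α)          ≤⟨ ℕ.+-monoˡ-≤ (17 ℕ.* (n ℕ.* size α)) (ℕ.*-monoʳ-≤ 8 1≤n*size) ⟩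
  8 ℕ.* (n ℕ.* size α) ℕ.+ 17 ℕ.* (n ℕ.* size α) ≡⟨ eq₂ (n ℕ.* size α) ⟩
  25 ℕ.* (n ℕ.* size α) ∎
  where
  open ℕ.≤-Reasoning
  n = samples t
  1≤n*size : 1 ℕ.≤ n ℕ.* size α
  1≤n*size = ℕ.*-mono-≤ {1} {n} {1} {size α}
    (ℕ.m≤n+m 1 (apply div (3 ℕ.* denominator t) (numerator t))) (ℕ.s≤s ℕ.z≤n)
  eq₁ : ∀ n s → 7 ℕ.+ (n ℕ.* (17 ℕ.* s) ℕ.+ 1) ≡ 8 ℕ.* 1 ℕ.+ 17 ℕ.* (n ℕ.* s)
  eq₁ = solve-∀
  eq₂ : ∀ x → 8 ℕ.* x ℕ.+ 17 ℕ.* x ≡ 25 ℕ.* x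
  eq₂ = solve-∀

timeNeeded-linear : ∀ α t → fromℕ (timeNeeded α t) ≤ fromℕ 100 * (fromℕ (size α) * 1/ε t)
timeNeeded-linear α t = begin
  fromℕ (timeNeeded α t)                      ≤⟨ fromℕ-mono-≤ (timeNeeded-≤ α t) ⟩
  fromℕ (25 ℕ.* (n ℕ.* size α))               ≡⟨ fromℕ-* 25 (n ℕ.* size α) ⟩
  fromℕ 25 * fromℕ (n ℕ.* size α)             ≡⟨ cong (fromℕ 25 *_) (fromℕ-* n (size α)) ⟩
  fromℕ 25 * (fromℕ n * s)                    ≤⟨ ℚ.*-monoˡ-≤-nonNeg (fromℕ 25)
                                                   (ℚ.*-monoʳ-≤-nonNeg s {{fromℕ-nonNegative (size α)}} (samples≤4/ε t)) ⟩
  fromℕ 25 * (fromℕ 4 * 1/ε t * s)            ≡⟨ solve 2 (λ x s → con (fromℕ 25) :* (con (fromℕ 4) :* x :* s) :=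
                                                   con (fromℕ 100) :* (s :* x)) refl (1/ε t) s ⟩
  fromℕ 100 * (s * 1/ε t)                     ∎
  where
  open ℚ.≤-Reasoning
  open +-*-Solver
  n = samples t
  s = fromℕ (size α)

-- The algorithm

tautologyTester : Algorithm
tautologyTester = record
  { program = tautologyTest
  ; halts   = λ α t → timeNeeded α t , Accepts.halting (run-tautologyTest α t)
  }

tautologyTester-linear : ∀ α t → WorksInTime tautologyTester α t (fromℕ 100 * (fromℕ (size α) * 1/ε t))
tautologyTester-linear α t =
  timeNeeded α t , timeNeeded-linear α t , Accepts.halting (run-tautologyTest α t)

tautologyTester-isPRAX : IsPRAX tautologyTester
tautologyTester-isPRAX = record
  { accepts    = λ α t 𝖡≡1 → Prob≡1⇒Always answer (execution tautologyTester α t)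
      (trans (Accepts.probability (run-tautologyTest α t))
             (trans (cong (_^ samples t) 𝖡≡1) (1^n≡1 (samples t))))
  ; rejects    = rejects
  ; polynomial = 100 , 1 , 1 , λ α t →
      subst (WorksInTime tautologyTester α t) (monomial (fromℕ (size α)) (1/ε t)) (tautologyTester-linear α t)
  }
  where
  monomial : ∀ x y → fromℕ 100 * (x * y) ≡ fromℕ 100 * x ^ 1 * y ^ 1
  monomial = solve 2 (λ x y → con (fromℕ 100) :* (x :* y) :=
                              con (fromℕ 100) :* (x :* con 1ℚ) :* (y :* con 1ℚ)) refl
    where open +-*-Solver
  rejects : ∀ α t → ¬ U𝖡,ε t α → + 3 / 4 ≤ Prob (λ s → not (answer s)) (execution tautologyTester α t)
  rejects α t ∉U = begin
    1ℚ - (+ 1 / 4)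
      ≤⟨ ℚ.+-monoʳ-≤ 1ℚ (ℚ.neg-antimono-≤ (power≤¼ {{𝖡-nonNegative α}} {{ℚ.nonNegative (ℚ.<⇒≤ (0<ε t))}}
           (ℚ.<⇒≤ (ℚ.≰⇒> ∉U)) (samples t) (samples-sufficient t))) ⟩
    1ℚ - 𝖡 α ^ samples t
      ≡⟨ cong (λ x → 1ℚ - x) (Accepts.probability (run-tautologyTest α t)) ⟨
    1ℚ - Prob answer (execution tautologyTester α t)
      ≡⟨ Prob-not answer (execution tautologyTester α t) (Accepts.halting (run-tautologyTest α t)) ⟨
    Prob (λ s → not (answer s)) (execution tautologyTester α t) ∎
    where open ℚ.≤-Reasoning

corollary6p2 : Σ[ A ∈ Algorithm ] (IsPRAX A ×
    (Σ[ C ∈ ℕ ] ∀ α t → WorksInTime A α t (fromℕ C * (fromℕ (size α) * 1/ε t))))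
corollary6p2 = tautologyTester , tautologyTester-isPRAX , 100 , tautologyTester-linear
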